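{- Let $T$ be a monoidal monad on $\mathbf{Set}$, let $\Sigma$ be a signature and $\cdot\in\Sigma$ a binary operation symbol. Let $t[-]$ be a $\Sigma$-term with a single hole containing no constants (nullary operation symbols), in which no variable occurs more than once and the variable $x$ does not occur. If $T$ preserves the equation $t[x]=t[x\cdot x]$, then $T$ is relevant.
   Context: $t[N]$ denotes the term obtained by placing the term $N$ in the hole of $t$. A monoidal monad on $\mathbf{Set}$ is a monad with natural $\psi_{X,Y}\colon TX\times TY\to T(X\times Y)$ making it lax monoidal with $\psi^0=\eta_1$ and with $\eta,\mu$ monoidal (equivalently a commutative monad); $\psi^n$ is its $n$-ary version. The lifting $\widehat T\mathcal A$ of a $\Sigma$-algebra $\mathcal A$ on $A$ has carrier $TA$ and operations $T\sigma_{\mathcal A}\circ\psi^{\mathrm{ar}(\sigma)}$; $T$ preserves an equation if $\widehat T\mathcal A$ satisfies it whenever $\mathcal A$ does. $T$ is relevant if $\psi_{A,B}\circ\langle T\pi_1,T\pi_2\rangle=\mathrm{id}_{T(A\times B)}$ for all sets $A,B$. -}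

module Defs where

open import Level using (Level; _⊔_) renaming (suc to lsuc)
open import Data.Nat.Base using (ℕ; zero; suc)
open import Data.Product.Base using (_×_; _,_; proj₁; proj₂; map; uncurry; assocʳ′)
open import Data.Unit.Polymorphic.Base using (⊤; tt)
open import Data.Vec.Base using (Vec; []; _∷_)
open import Data.Vec.Relation.Unary.All using (All)
open import Data.List.Base using (List; []; _∷_; _++_)
open import Function.Base using (_∘_; id)
open import Relation.Binary.PropositionalEquality using (_≡_; _≗_)

private
  variable
    ℓ s v : Level
    n : ℕ
    A B C D : Set ℓ

-- Equality of maps between sets is pointwise equality, so without function
-- extensionality the fact that a functor respects equality of maps
-- (fmap-cong) has to be recorded as a law.
record Monad (ℓ : Level) : Set (lsuc ℓ) where
  field
    T    : Set ℓ → Set ℓ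
    fmap : {A B : Set ℓ} → (A → B) → T A → T B
    η    : {A : Set ℓ} → A → T A
    μ    : {A : Set ℓ} → T (T A) → T A

    fmap-cong : {A B : Set ℓ} {f g : A → B} → f ≗ g → fmap f ≗ fmap g
    fmap-id   : {A : Set ℓ} → fmap (id {A = A}) ≗ id
    fmap-∘    : {A B C : Set ℓ} (g : B → C) (f : A → B) →
                fmap (g ∘ f) ≗ fmap g ∘ fmap f

    η-natural : {A B : Set ℓ} (f : A → B) → fmap f ∘ η ≗ η ∘ f
    μ-natural : {A B : Set ℓ} (f : A → B) → fmap f ∘ μ ≗ μ ∘ fmap (fmap f)

    μ-identityˡ : {A : Set ℓ} → μ {A} ∘ η ≗ id
    μ-identityʳ : {A : Set ℓ} → μ {A} ∘ fmap η ≗ id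
    μ-assoc     : {A : Set ℓ} → μ {A} ∘ μ ≗ μ ∘ fmap μ

record MonoidalMonad (ℓ : Level) : Set (lsuc ℓ) where
  field
    monad : Monad ℓ

  open Monad monad public

  ψ⁰ : T ⊤
  ψ⁰ = η tt

  field
    ψ : {A B : Set ℓ} → T A × T B → T (A × B)

    ψ-natural : {A B C D : Set ℓ} (f : A → C) (g : B → D) →
                fmap (map f g) ∘ ψ ≗ ψ ∘ map (fmap f) (fmap g)

    ψ-identityˡ : {A : Set ℓ} (t : T A) → fmap proj₂ (ψ (ψ⁰ , t)) ≡ t
    ψ-identityʳ : {A : Set ℓ} (t : T A) → fmap proj₁ (ψ (t , ψ⁰)) ≡ t
    ψ-assoc     : {A B C : Set ℓ} (r : T A) (s : T B) (t : T C) →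
                  fmap assocʳ′ (ψ (ψ (r , s) , t)) ≡ ψ (r , ψ (s , t))

    -- The nullary conditions on η and μ hold by the definition of ψ⁰ and by
    -- the unit laws of the monad.
    η-monoidal : {A B : Set ℓ} (a : A) (b : B) → ψ (η a , η b) ≡ η (a , b)
    μ-monoidal : {A B : Set ℓ} (s : T (T A)) (t : T (T B)) →
                 μ (fmap ψ (ψ (s , t))) ≡ ψ (μ s , μ t)

  ψⁿ : {A : Set ℓ} {n : ℕ} → Vec (T A) n → T (Vec A n)
  ψⁿ []       = fmap (λ _ → []) ψ⁰
  ψⁿ (t ∷ ts) = fmap (uncurry _∷_) (ψ (t , ψⁿ ts))

  Relevant : Set (lsuc ℓ)
  Relevant = {A B : Set ℓ} (t : T (A × B)) → ψ (fmap proj₁ t , fmap proj₂ t) ≡ t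

-- Σ n is the set of operation symbols of arity n.
Signature : (s : Level) → Set (lsuc s)
Signature s = ℕ → Set s

data Term (Σ : Signature s) (V : Set v) : Set (s ⊔ v) where
  var : V → Term Σ V
  op  : {n : ℕ} → Σ n → Vec (Term Σ V) n → Term Σ V

-- Terms with exactly one hole.  Contexts Σ V n consists of argument lists of
-- length n in which exactly one argument contains the hole.
mutual
  data Context (Σ : Signature s) (V : Set v) : Set (s ⊔ v) where
    hole : Context Σ V
    op   : {n : ℕ} → Σ n → Contexts Σ V n → Context Σ V

  data Contexts (Σ : Signature s) (V : Set v) : ℕ → Set (s ⊔ v) where
    here  : {n : ℕ} → Context Σ V → Vec (Term Σ V) n → Contexts Σ V (suc n)
    there : {n : ℕ} → Term Σ V → Contexts Σ V n → Contexts Σ V (suc n)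

module _ {Σ : Signature s} {V : Set v} where

  mutual
    _[_] : Context Σ V → Term Σ V → Term Σ V
    hole    [ N ] = N
    op σ ts [ N ] = op σ (ts [ N ]ˢ)

    _[_]ˢ : Contexts Σ V n → Term Σ V → Vec (Term Σ V) n
    here t us  [ N ]ˢ = t [ N ] ∷ us
    there u ts [ N ]ˢ = u ∷ ts [ N ]ˢ

  -- Lists of variable occurrences, with multiplicity.
  mutual
    vars : Term Σ V → List V
    vars (var x)   = x ∷ []
    vars (op σ ts) = varsˢ ts

    varsˢ : Vec (Term Σ V) n → List V
    varsˢ []       = []
    varsˢ (t ∷ ts) = vars t ++ varsˢ ts

  mutual
    contextVars : Context Σ V → List V
    contextVars hole      = []
    contextVars (op σ ts) = contextVarsˢ ts

    contextVarsˢ : Contexts Σ V n → List V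
    contextVarsˢ (here t us)  = contextVars t ++ varsˢ us
    contextVarsˢ (there u ts) = vars u ++ contextVarsˢ ts

  data ConstantFree : Term Σ V → Set (s ⊔ v) where
    var : (x : V) → ConstantFree (var x)
    op  : {n : ℕ} (σ : Σ (suc n)) {ts : Vec (Term Σ V) (suc n)} →
          All ConstantFree ts → ConstantFree (op σ ts)

  -- A symbol above the hole is never nullary, since Contexts Σ V zero is empty.
  mutual
    data ConstantFreeContext : Context Σ V → Set (s ⊔ v) where
      hole : ConstantFreeContext hole
      op   : {n : ℕ} (σ : Σ n) {ts : Contexts Σ V n} →
             ConstantFreeContexts ts → ConstantFreeContext (op σ ts)

    data ConstantFreeContexts : {n : ℕ} → Contexts Σ V n → Set (s ⊔ v) where
      here  : {n : ℕ} {t : Context Σ V} {us : Vec (Term Σ V) n} →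
              ConstantFreeContext t → All ConstantFree us →
              ConstantFreeContexts (here t us)
      there : {n : ℕ} {u : Term Σ V} {ts : Contexts Σ V n} →
              ConstantFree u → ConstantFreeContexts ts →
              ConstantFreeContexts (there u ts)

Algebra : Signature s → Set ℓ → Set (s ⊔ ℓ)
Algebra Σ A = {n : ℕ} → Σ n → Vec A n → A

module _ {Σ : Signature s} {V : Set v} {A : Set ℓ} (𝒜 : Algebra Σ A) (ρ : V → A) where

  mutual
    ⟦_⟧ : Term Σ V → A
    ⟦ var x ⟧   = ρ x
    ⟦ op σ ts ⟧ = 𝒜 σ ⟦ ts ⟧ˢ

    ⟦_⟧ˢ : Vec (Term Σ V) n → Vec A n
    ⟦ [] ⟧ˢ     = []
    ⟦ t ∷ ts ⟧ˢ = ⟦ t ⟧ ∷ ⟦ ts ⟧ˢ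

infix 4 _≈_

record Equation (Σ : Signature s) (V : Set v) : Set (s ⊔ v) where
  constructor _≈_
  field
    lhs rhs : Term Σ V

Satisfies : {Σ : Signature s} {V : Set v} {A : Set ℓ} →
            Algebra Σ A → Equation Σ V → Set (v ⊔ ℓ)
Satisfies {V = V} {A = A} 𝒜 (l ≈ r) = (ρ : V → A) → ⟦_⟧ 𝒜 ρ l ≡ ⟦_⟧ 𝒜 ρ r

module _ (M : MonoidalMonad ℓ) where
  open MonoidalMonad M

  lift : {Σ : Signature s} {A : Set ℓ} → Algebra Σ A → Algebra Σ (T A)
  lift 𝒜 σ = fmap (𝒜 σ) ∘ ψⁿ

  Preserves : {Σ : Signature s} {V : Set v} → Equation Σ V → Set (s ⊔ v ⊔ lsuc ℓ)
  Preserves {Σ = Σ} e = {A : Set ℓ} (𝒜 : Algebra Σ A) →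
                        Satisfies 𝒜 e → Satisfies (lift 𝒜) e

{-# OPTIONS --safe #-}

-- Adjoin a unit to the rectangular band A × B, (a , b) ∙ (a′ , b′) = (a , b′),
-- and interpret every n-ary symbol as the n-fold product in the resulting
-- idempotent monoid, which satisfies t[x] = t[x · x].  In the lifted algebra,
-- send every variable other than x to η of the unit: then t[-] acts as the
-- identity.  Sending x to s, an element of T (A × B), the lifted equation says
-- that s and ψ (T π₁ s , T π₂ s) become equal after the unit is adjoined.
-- Adjoining the unit is injective on T (A × B) because s itself can serve as
-- the image of the unit under a Kleisli retraction; A × B may be empty.
module Submission where

open import Defs
open import Level using (Level)
open import Data.Vec.Base using ([]; _∷_)
open import Data.List.Membership.Propositional using (_∉_)
open import Data.List.Relation.Unary.Unique.Propositional using (Unique)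
open import Relation.Binary.Definitions using (DecidableEquality)

open import Data.Nat.Base using (ℕ)
open import Data.Product.Base using (_×_; _,_; proj₁; proj₂; map; uncurry)
open import Data.Unit.Polymorphic.Base using (tt)
open import Data.Vec.Base using (Vec; foldr′)
open import Data.List.Relation.Unary.All as All using (All; []; _∷_)
open import Data.List.Relation.Unary.All.Properties using (++⁻; ¬Any⇒All¬)
open import Data.Maybe.Base using (Maybe; just; nothing; maybe′)
open import Function.Base using (_∘_; id; const)
open import Relation.Nullary.Decidable.Core using (yes; no)
open import Relation.Nullary.Negation.Core using (contradiction)
open import Relation.Binary.PropositionalEquality
  using (_≡_; _≢_; refl; sym; trans; cong; cong₂; module ≡-Reasoning)

private
  variable
    ℓ s v : Level
    n : ℕ
    A B : Set ℓ

-- Evaluation of contexts.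

module _ {Σ : Signature s} {V : Set v} (𝒜 : Algebra Σ A) (ρ : V → A) where

  mutual
    -- The hole takes a value instead of a term, so that a context becomes a map on the carrier to
    -- which `fmap` can be applied.
    ⟦_⟧ᶜ : Context Σ V → A → A
    ⟦ hole ⟧ᶜ    a = a
    ⟦ op σ ts ⟧ᶜ a = 𝒜 σ (⟦ ts ⟧ᶜˢ a)

    ⟦_⟧ᶜˢ : Contexts Σ V n → A → Vec A n
    ⟦ here t us ⟧ᶜˢ  a = ⟦ t ⟧ᶜ a ∷ ⟦_⟧ˢ 𝒜 ρ us
    ⟦ there u ts ⟧ᶜˢ a = ⟦_⟧ 𝒜 ρ u ∷ ⟦ ts ⟧ᶜˢ a

  mutual
    ⟦[]⟧-cong : (t : Context Σ V) {N N′ : Term Σ V} →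
                ⟦_⟧ 𝒜 ρ N ≡ ⟦_⟧ 𝒜 ρ N′ → ⟦_⟧ 𝒜 ρ (t [ N ]) ≡ ⟦_⟧ 𝒜 ρ (t [ N′ ])
    ⟦[]⟧-cong hole      eq = eq
    ⟦[]⟧-cong (op σ ts) eq = cong (𝒜 σ) (⟦[]⟧ˢ-cong ts eq)

    ⟦[]⟧ˢ-cong : (ts : Contexts Σ V n) {N N′ : Term Σ V} →
                 ⟦_⟧ 𝒜 ρ N ≡ ⟦_⟧ 𝒜 ρ N′ →
                 ⟦_⟧ˢ 𝒜 ρ (ts [ N ]ˢ) ≡ ⟦_⟧ˢ 𝒜 ρ (ts [ N′ ]ˢ)
    ⟦[]⟧ˢ-cong (here t us)  eq = cong (_∷ _) (⟦[]⟧-cong t eq)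
    ⟦[]⟧ˢ-cong (there u ts) eq = cong (_ ∷_) (⟦[]⟧ˢ-cong ts eq)

-- Pure arguments in a monoidal monad and in lifted algebras.

module _ (M : MonoidalMonad ℓ) where
  open MonoidalMonad M
  open ≡-Reasoning

  -- Since `η a` is the image of `ψ⁰` under `const a`, naturality of `ψ` reduces the claim to its
  -- left unit law.
  ψ-ηˡ : (a : A) (q : T B) → ψ (η a , q) ≡ fmap (a ,_) q
  ψ-ηˡ a q = begin
    ψ (η a , q)
      ≡⟨ cong ψ (cong₂ _,_ (η-natural (const a) tt) (fmap-id q)) ⟨
    ψ (fmap (const a) ψ⁰ , fmap id q)
      ≡⟨ ψ-natural (const a) id (ψ⁰ , q) ⟨
    fmap ((a ,_) ∘ proj₂) (ψ (ψ⁰ , q))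
      ≡⟨ fmap-∘ (a ,_) proj₂ _ ⟩
    fmap (a ,_) (fmap proj₂ (ψ (ψ⁰ , q)))
      ≡⟨ cong (fmap (a ,_)) (ψ-identityˡ q) ⟩
    fmap (a ,_) q ∎

  ψ-ηʳ : (p : T A) (b : B) → ψ (p , η b) ≡ fmap (_, b) p
  ψ-ηʳ p b = begin
    ψ (p , η b)
      ≡⟨ cong ψ (cong₂ _,_ (fmap-id p) (η-natural (const b) tt)) ⟨
    ψ (fmap id p , fmap (const b) ψ⁰)
      ≡⟨ ψ-natural id (const b) (p , ψ⁰) ⟨
    fmap ((_, b) ∘ proj₁) (ψ (p , ψ⁰))
      ≡⟨ fmap-∘ (_, b) proj₁ _ ⟩
    fmap (_, b) (fmap proj₁ (ψ (p , ψ⁰)))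
      ≡⟨ cong (fmap (_, b)) (ψ-identityʳ p) ⟩
    fmap (_, b) p ∎

  -- The recursion of `ψⁿ` ends in `ψⁿ []`, which is `η []`; pairing with this pure value only
  -- relabels, so a single `ψ` remains.
  ψⁿ-pair : (p q : T A) →
            ψⁿ (p ∷ q ∷ []) ≡ fmap (λ (a , b) → a ∷ b ∷ []) (ψ (p , q))
  ψⁿ-pair p q = begin
    fmap (uncurry _∷_) (ψ (p , fmap (uncurry _∷_) (ψ (q , ψⁿ []))))
      ≡⟨ cong (λ r → fmap (uncurry _∷_) (ψ (p , fmap (uncurry _∷_) (ψ (q , r)))))
              (η-natural _ tt) ⟩
    fmap (uncurry _∷_) (ψ (p , fmap (uncurry _∷_) (ψ (q , η []))))
      ≡⟨ cong (λ r → fmap (uncurry _∷_) (ψ (p , fmap (uncurry _∷_) r)))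
              (ψ-ηʳ q []) ⟩
    fmap (uncurry _∷_) (ψ (p , fmap (uncurry _∷_) (fmap (_, []) q)))
      ≡⟨ cong (λ r → fmap (uncurry _∷_) (ψ r))
              (cong₂ _,_ (fmap-id p) (fmap-∘ (uncurry _∷_) (_, []) q)) ⟨
    fmap (uncurry _∷_) (ψ (fmap id p , fmap (_∷ []) q))
      ≡⟨ cong (fmap (uncurry _∷_)) (ψ-natural id (_∷ []) (p , q)) ⟨
    fmap (uncurry _∷_) (fmap (map id (_∷ [])) (ψ (p , q)))
      ≡⟨ fmap-∘ (uncurry _∷_) (map id (_∷ [])) _ ⟨
    fmap (λ (a , b) → a ∷ b ∷ []) (ψ (p , q)) ∎

  fmap-just-injective : {p q : T A} → fmap just p ≡ fmap just q → p ≡ q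
  fmap-just-injective {p = p} {q} eq = begin
    p                           ≡⟨ retract-just p ⟨
    retract (fmap just p)       ≡⟨ cong retract eq ⟩
    retract (fmap just q)       ≡⟨ retract-just q ⟩
    q                           ∎
    where
    retract : T (Maybe _) → T _
    -- The value at `nothing` may be any element of `T A`, and `p` is one at hand. After `just` only
    -- `η` remains, so the right unit law applies.
    retract = μ ∘ fmap (maybe′ η p)

    retract-just : ∀ r → retract (fmap just r) ≡ r
    retract-just r = trans (cong μ (sym (fmap-∘ (maybe′ η p) just r))) (μ-identityʳ r)

  module _ {Σ : Signature s} {V : Set v} (𝒜 : Algebra Σ A) (ρ : V → T A) (σ : V → A) where

    private
      Pure : V → Set ℓ
      Pure y = ρ y ≡ η (σ y)

    mutual
      -- By `η-monoidal` and `η-natural`, `η` is a homomorphism from `𝒜` to its lifting, so it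
      -- commutes with the evaluation of terms.
      lift-η : (u : Term Σ V) → All Pure (vars u) →
               ⟦_⟧ (lift M 𝒜) ρ u ≡ η (⟦_⟧ 𝒜 σ u)
      lift-η (var y)   (py ∷ []) = py
      lift-η (op f us) pure      =
        trans (cong (fmap (𝒜 f)) (lift-ηˢ us pure)) (η-natural (𝒜 f) _)

      lift-ηˢ : (us : Vec (Term Σ V) n) → All Pure (varsˢ us) →
                ψⁿ (⟦_⟧ˢ (lift M 𝒜) ρ us) ≡ η (⟦_⟧ˢ 𝒜 σ us)
      lift-ηˢ []       _    = η-natural _ tt
      lift-ηˢ (u ∷ us) pure with pu , pus ← ++⁻ (vars u) pure = begin
        fmap (uncurry _∷_) (ψ (⟦_⟧ (lift M 𝒜) ρ u , ψⁿ (⟦_⟧ˢ (lift M 𝒜) ρ us)))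
          ≡⟨ cong (fmap (uncurry _∷_) ∘ ψ) (cong₂ _,_ (lift-η u pu) (lift-ηˢ us pus)) ⟩
        fmap (uncurry _∷_) (ψ (η (⟦_⟧ 𝒜 σ u) , η (⟦_⟧ˢ 𝒜 σ us)))
          ≡⟨ cong (fmap (uncurry _∷_)) (η-monoidal _ _) ⟩
        fmap (uncurry _∷_) (η (⟦_⟧ 𝒜 σ u , ⟦_⟧ˢ 𝒜 σ us))
          ≡⟨ η-natural (uncurry _∷_) _ ⟩
        η (⟦_⟧ˢ 𝒜 σ (u ∷ us)) ∎

    mutual
      -- Along the path to the hole every side argument is pure. Each `ψ` there has a pure component
      -- and is turned into an `fmap` by `ψ-ηˡ` or `ψ-ηʳ`; these compose to one `fmap`.
      lift-context : (t : Context Σ V) (N : Term Σ V) → All Pure (contextVars t) →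
                     ⟦_⟧ (lift M 𝒜) ρ (t [ N ]) ≡
                     fmap (⟦_⟧ᶜ 𝒜 σ t) (⟦_⟧ (lift M 𝒜) ρ N)
      lift-context hole      N _    = sym (fmap-id _)
      lift-context (op f ts) N pure =
        trans (cong (fmap (𝒜 f)) (lift-contextˢ ts N pure)) (sym (fmap-∘ (𝒜 f) _ _))

      lift-contextˢ : (ts : Contexts Σ V n) (N : Term Σ V) → All Pure (contextVarsˢ ts) →
                      ψⁿ (⟦_⟧ˢ (lift M 𝒜) ρ (ts [ N ]ˢ)) ≡
                      fmap (⟦_⟧ᶜˢ 𝒜 σ ts) (⟦_⟧ (lift M 𝒜) ρ N)
      lift-contextˢ (here t us) N pure with pt , pus ← ++⁻ (contextVars t) pure = begin
        fmap (uncurry _∷_)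
          (ψ (⟦_⟧ (lift M 𝒜) ρ (t [ N ]) , ψⁿ (⟦_⟧ˢ (lift M 𝒜) ρ us)))
          ≡⟨ cong (fmap (uncurry _∷_) ∘ ψ)
                  (cong₂ _,_ (lift-context t N pt) (lift-ηˢ us pus)) ⟩
        fmap (uncurry _∷_) (ψ (fmap (⟦_⟧ᶜ 𝒜 σ t) r , η (⟦_⟧ˢ 𝒜 σ us)))
          ≡⟨ cong (fmap (uncurry _∷_)) (ψ-ηʳ _ _) ⟩
        fmap (uncurry _∷_) (fmap (_, ⟦_⟧ˢ 𝒜 σ us) (fmap (⟦_⟧ᶜ 𝒜 σ t) r))
          ≡⟨ cong (fmap (uncurry _∷_)) (fmap-∘ _ _ r) ⟨
        fmap (uncurry _∷_) (fmap ((_, ⟦_⟧ˢ 𝒜 σ us) ∘ ⟦_⟧ᶜ 𝒜 σ t) r)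
          ≡⟨ fmap-∘ _ _ r ⟨
        fmap (⟦_⟧ᶜˢ 𝒜 σ (here t us)) r ∎
        where r = ⟦_⟧ (lift M 𝒜) ρ N
      lift-contextˢ (there u ts) N pure with pu , pts ← ++⁻ (vars u) pure = begin
        fmap (uncurry _∷_)
          (ψ (⟦_⟧ (lift M 𝒜) ρ u , ψⁿ (⟦_⟧ˢ (lift M 𝒜) ρ (ts [ N ]ˢ))))
          ≡⟨ cong (fmap (uncurry _∷_) ∘ ψ)
                  (cong₂ _,_ (lift-η u pu) (lift-contextˢ ts N pts)) ⟩
        fmap (uncurry _∷_) (ψ (η (⟦_⟧ 𝒜 σ u) , fmap (⟦_⟧ᶜˢ 𝒜 σ ts) r))
          ≡⟨ cong (fmap (uncurry _∷_)) (ψ-ηˡ _ _) ⟩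
        fmap (uncurry _∷_) (fmap (⟦_⟧ 𝒜 σ u ,_) (fmap (⟦_⟧ᶜˢ 𝒜 σ ts) r))
          ≡⟨ cong (fmap (uncurry _∷_)) (fmap-∘ _ _ r) ⟨
        fmap (uncurry _∷_) (fmap ((⟦_⟧ 𝒜 σ u ,_) ∘ ⟦_⟧ᶜˢ 𝒜 σ ts) r)
          ≡⟨ fmap-∘ _ _ r ⟨
        fmap (⟦_⟧ᶜˢ 𝒜 σ (there u ts)) r ∎
        where r = ⟦_⟧ (lift M 𝒜) ρ N

-- The rectangular band with a unit.

infixr 7 _∙_

_∙_ : Maybe (A × B) → Maybe (A × B) → Maybe (A × B)
nothing      ∙ q             = q
just p       ∙ nothing       = just p
just (a , _) ∙ just (_ , b′) = just (a , b′)

∙-identityʳ : (p : Maybe (A × B)) → p ∙ nothing ≡ p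
∙-identityʳ nothing  = refl
∙-identityʳ (just _) = refl

∙-idem : (p : Maybe (A × B)) → p ∙ p ≡ p
∙-idem nothing  = refl
∙-idem (just _) = refl

-- The fold starts from the unit, so a binary symbol sends `p` and `q` to `p ∙ q ∙ nothing`; this is
-- the source of the trailing `nothing` below.
productAlgebra : {Σ : Signature s} → Algebra Σ (Maybe (A × B))
productAlgebra _ = foldr′ _∙_ nothing

module _ {Σ : Signature s} {V : Set v} {A B : Set ℓ} where

  private
    𝒫 : Algebra Σ (Maybe (A × B))
    𝒫 = productAlgebra {Σ = Σ}

    units : V → Maybe (A × B)
    units _ = nothing

  product-pair-idem : (p : Maybe (A × B)) → p ∙ p ∙ nothing ≡ p
  product-pair-idem p = trans (cong (p ∙_) (∙-identityʳ p)) (∙-idem p)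

  -- By idempotence both fillings of the hole have the same value under every valuation, and
  -- contexts respect equality of values.
  product-satisfies : (t : Context Σ V) (· : Σ 2) (N : Term Σ V) →
                      Satisfies 𝒫 (t [ N ] ≈ t [ op · (N ∷ N ∷ []) ])
  product-satisfies t · N ρ = ⟦[]⟧-cong 𝒫 ρ t (sym (product-pair-idem (⟦_⟧ 𝒫 ρ N)))

  mutual
    product-units : (u : Term Σ V) → ⟦_⟧ 𝒫 units u ≡ nothing
    product-units (var _)   = refl
    product-units (op _ us) = product-unitsˢ us

    product-unitsˢ : (us : Vec (Term Σ V) n) → foldr′ _∙_ nothing (⟦_⟧ˢ 𝒫 units us) ≡ nothing
    product-unitsˢ []       = refl
    product-unitsˢ (u ∷ us) = cong₂ _∙_ (product-units u) (product-unitsˢ us)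

  mutual
    -- All side arguments evaluate to the unit, so every product on the path to the hole collapses
    -- to the factor containing the hole.
    product-context : (t : Context Σ V) (p : Maybe (A × B)) → ⟦_⟧ᶜ 𝒫 units t p ≡ p
    product-context hole      p = refl
    product-context (op _ ts) p = product-contextˢ ts p

    product-contextˢ : (ts : Contexts Σ V n) (p : Maybe (A × B)) →
                       foldr′ _∙_ nothing (⟦_⟧ᶜˢ 𝒫 units ts p) ≡ p
    product-contextˢ (here t us)  p =
      trans (cong₂ _∙_ (product-context t p) (product-unitsˢ us)) (∙-identityʳ p)
    product-contextˢ (there u ts) p =
      cong₂ _∙_ (product-units u) (product-contextˢ ts p)

theorem5 : {ℓ s v : Level} (M : MonoidalMonad ℓ) →
    (Σ : Signature s) (· : Σ 2) →
    (V : Set v) → DecidableEquality V →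
    (t : Context Σ V) (x : V) →
    ConstantFreeContext t →
    Unique (contextVars t) →
    x ∉ contextVars t →
    Preserves M (t [ var x ] ≈ t [ op · (var x ∷ var x ∷ []) ]) →
    MonoidalMonad.Relevant M
theorem5 M Σ · V _≟_ t x _ _ x∉t preserves {A} {B} r =
  sym (fmap-just-injective M (begin
    fmap just r
      ≡⟨ ρ-x ⟨
    ⟦_⟧ 𝒫̂ ρ (var x)
      ≡⟨ evaluate-context (var x) ⟨
    ⟦_⟧ 𝒫̂ ρ (t [ var x ])
      ≡⟨ preserves 𝒫 (product-satisfies t · (var x)) ρ ⟩
    ⟦_⟧ 𝒫̂ ρ (t [ x·x ])
      ≡⟨ evaluate-context x·x ⟩
    fmap product (ψⁿ (ρ x ∷ ρ x ∷ []))
      ≡⟨ cong (λ p → fmap product (ψⁿ (p ∷ p ∷ []))) ρ-x ⟩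
    fmap product (ψⁿ (fmap just r ∷ fmap just r ∷ []))
      ≡⟨ cong (fmap product) (ψⁿ-pair M _ _) ⟩
    fmap product (fmap (λ (p , q) → p ∷ q ∷ []) (ψ (fmap just r , fmap just r)))
      ≡⟨ fmap-∘ _ _ _ ⟨
    fmap (λ (p , q) → p ∙ q ∙ nothing) (ψ (fmap just r , fmap just r))
      ≡⟨ cong (fmap _) (ψ-natural just just (r , r)) ⟨
    fmap (λ (p , q) → p ∙ q ∙ nothing) (fmap (map just just) (ψ (r , r)))
      -- On two `just` values the product `p ∙ q ∙ nothing` computes to `just` of the first
      -- component of `p` and the second of `q`, so the composite with `map just just` is
      -- definitionally `just ∘ map proj₁ proj₂`.
      ≡⟨ fmap-∘ _ _ _ ⟨
    fmap (just ∘ map proj₁ proj₂) (ψ (r , r))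
      ≡⟨ fmap-∘ just (map proj₁ proj₂) _ ⟩
    fmap just (fmap (map proj₁ proj₂) (ψ (r , r)))
      ≡⟨ cong (fmap just) (ψ-natural proj₁ proj₂ (r , r)) ⟩
    fmap just (ψ (fmap proj₁ r , fmap proj₂ r)) ∎))
  where
  open MonoidalMonad M
  open ≡-Reasoning

  product : ∀ {n} → Vec (Maybe (A × B)) n → Maybe (A × B)
  product = foldr′ _∙_ nothing

  𝒫 : Algebra Σ (Maybe (A × B))
  𝒫 = productAlgebra {Σ = Σ}

  𝒫̂ : Algebra Σ (T (Maybe (A × B)))
  𝒫̂ = lift M {Σ = Σ} 𝒫

  x·x : Term Σ V
  x·x = op · (var x ∷ var x ∷ [])

  ρ : V → T (Maybe (A × B))
  ρ y with x ≟ y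
  ... | yes _ = fmap just r
  ... | no  _ = η nothing

  ρ-x : ρ x ≡ fmap just r
  ρ-x with x ≟ x
  ... | yes _   = refl
  ... | no  x≢x = contradiction refl x≢x

  ρ-≢x : ∀ {y} → x ≢ y → ρ y ≡ η nothing
  ρ-≢x {y} x≢y with x ≟ y
  ... | yes x≡y = contradiction x≡y x≢y
  ... | no  _   = refl

  -- As `x` does not occur in `t`, all variables of the context are pure with value the unit. The
  -- lifted context is then `fmap` of a map that is pointwise the identity.
  evaluate-context : (N : Term Σ V) → ⟦_⟧ 𝒫̂ ρ (t [ N ]) ≡ ⟦_⟧ 𝒫̂ ρ N
  evaluate-context N = begin
    ⟦_⟧ 𝒫̂ ρ (t [ N ])
      ≡⟨ lift-context M 𝒫 ρ (const nothing) t N (All.map ρ-≢x (¬Any⇒All¬ _ x∉t)) ⟩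
    fmap (⟦_⟧ᶜ 𝒫 (const nothing) t) (⟦_⟧ 𝒫̂ ρ N)
      ≡⟨ fmap-cong (product-context t) _ ⟩
    fmap id (⟦_⟧ 𝒫̂ ρ N)
      ≡⟨ fmap-id _ ⟩
    ⟦_⟧ 𝒫̂ ρ N ∎
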